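{- Let $A$ be a bounded distributive lattice and $X$ its Priestley space. The following are equivalent: (1) $A$ is proHeyting; (2) for all clopen upsets $U,V$ of $X$, $X\setminus{\downarrow}(U\setminus V)$ is a DM-set; (3) for every clopen subset $U$ of $X$, $X\setminus{\downarrow}U$ is a DM-set.
   Context: A relative annihilator of $A$ is $\langle a,b\rangle=\{x\in A:a\wedge x\le b\}$; $A$ is proHeyting if every relative annihilator is a normal ideal (a downset $N$ with $N=N^{u\ell}$). The Priestley space $X$ of $A$ is the set of prime filters ordered by inclusion, topologized by the basis $\{\mathfrak s(a)\setminus\mathfrak s(b)\}$ with $\mathfrak s(a)=\{x:a\in x\}$; $\mathfrak s$ is an isomorphism of $A$ onto the clopen upsets of $X$. With ${\sf cl}$ the topological closure, ${\sf cl_2}(S)={\uparrow}{\sf cl}(S)$ and ${\sf int_1}(S)=X\setminus{\downarrow}(X\setminus{\sf int}(S))$, a DM-set is an open upset $U$ with ${\sf int_1\,cl_2}(U)=U$. -}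

module Defs where

open import Level using (Level; _⊔_; suc)
open import Function.Base using (flip)
open import Data.Product.Base using (_×_; ∃₂; ∃-syntax)
open import Data.Sum.Base using (_⊎_)
open import Algebra.Definitions using (_DistributesOverˡ_)
open import Relation.Binary.Core using (Rel)
open import Relation.Binary.Definitions using (_Respects_)
open import Relation.Binary.Lattice.Bundles using (BoundedLattice)
open import Relation.Unary using (Pred; _∈_; _∉_; _⊆_; _≐_; _≬_; ∁; _∖_)

record BoundedDistributiveLattice c ℓ₁ ℓ₂ : Set (suc (c ⊔ ℓ₁ ⊔ ℓ₂)) where
  field
    boundedLattice : BoundedLattice c ℓ₁ ℓ₂
  open BoundedLattice boundedLattice public
  field
    ∧-distribˡ-∨ : _DistributesOverˡ_ _≈_ _∧_ _∨_

module ProHeyting {c ℓ₁ ℓ₂} (A : BoundedDistributiveLattice c ℓ₁ ℓ₂) where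
  open BoundedDistributiveLattice A

  infix 10 _ᵘ _ˡ

  _ᵘ : ∀ {q} → Pred Carrier q → Pred Carrier (c ⊔ ℓ₂ ⊔ q)
  (S ᵘ) y = ∀ x → x ∈ S → x ≤ y

  _ˡ : ∀ {q} → Pred Carrier q → Pred Carrier (c ⊔ ℓ₂ ⊔ q)
  (S ˡ) y = ∀ x → x ∈ S → y ≤ x

  IsDownset : ∀ {q} → Pred Carrier q → Set (c ⊔ ℓ₂ ⊔ q)
  IsDownset N = N Respects (flip _≤_)

  IsNormalIdeal : ∀ {q} → Pred Carrier q → Set (c ⊔ ℓ₂ ⊔ q)
  IsNormalIdeal N = IsDownset N × N ≐ (N ᵘ) ˡ

  ⟨_,_⟩ : Carrier → Carrier → Pred Carrier ℓ₂
  ⟨ a , b ⟩ x = a ∧ x ≤ b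

  IsProHeyting : Set (c ⊔ ℓ₂)
  IsProHeyting = ∀ a b → IsNormalIdeal ⟨ a , b ⟩

-- Subsets of the space are predicates on X. Two points of X are equal as
-- filters when each is ⊑ the other; open and closed predicates respect this
-- equality automatically, because the basic sets 𝔰 a ∖ 𝔰 b do.
module Priestley {c ℓ₁ ℓ₂} (A : BoundedDistributiveLattice c ℓ₁ ℓ₂) where
  open BoundedDistributiveLattice A

  private
    p = c ⊔ ℓ₁ ⊔ ℓ₂

  record PrimeFilter : Set (suc p) where
    field
      member   : Pred Carrier p
      up       : member Respects _≤_
      ⊤-member : ⊤ ∈ member
      ∧-member : ∀ {a b} → a ∈ member → b ∈ member → a ∧ b ∈ member
      ⊥-proper : ⊥ ∉ member
      prime    : ∀ {a b} → a ∨ b ∈ member → a ∈ member ⊎ b ∈ member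
  open PrimeFilter public

  X : Set (suc p)
  X = PrimeFilter

  infix 4 _⊑_
  _⊑_ : Rel X p
  x ⊑ y = member x ⊆ member y

  𝔰 : Carrier → Pred X p
  𝔰 a x = a ∈ member x

  IsOpen : ∀ {q} → Pred X q → Set (suc p ⊔ q)
  IsOpen U = ∀ {x} → x ∈ U → ∃₂ λ a b → x ∈ 𝔰 a ∖ 𝔰 b × 𝔰 a ∖ 𝔰 b ⊆ U

  IsClosed : ∀ {q} → Pred X q → Set (suc p ⊔ q)
  IsClosed F = IsOpen (∁ F)

  IsClopen : ∀ {q} → Pred X q → Set (suc p ⊔ q)
  IsClopen U = IsOpen U × IsClosed U

  IsUpset : ∀ {q} → Pred X q → Set (suc p ⊔ q)
  IsUpset U = U Respects _⊑_

  -- Interior and closure through basic neighbourhoods; quantifying over all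
  -- open or closed sets instead would raise the universe level.
  int : ∀ {q} → Pred X q → Pred X (suc p ⊔ q)
  int S x = ∃₂ λ a b → x ∈ 𝔰 a ∖ 𝔰 b × 𝔰 a ∖ 𝔰 b ⊆ S

  cl : ∀ {q} → Pred X q → Pred X (suc p ⊔ q)
  cl S x = ∀ a b → x ∈ 𝔰 a ∖ 𝔰 b → (𝔰 a ∖ 𝔰 b) ≬ S

  infix 8 ↑_ ↓_
  ↑_ : ∀ {q} → Pred X q → Pred X (suc p ⊔ q)
  (↑ S) x = ∃[ y ] y ∈ S × y ⊑ x

  ↓_ : ∀ {q} → Pred X q → Pred X (suc p ⊔ q)
  (↓ S) x = ∃[ y ] y ∈ S × x ⊑ y

  cl₂ : ∀ {q} → Pred X q → Pred X (suc p ⊔ q)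
  cl₂ S = ↑ cl S

  int₁ : ∀ {q} → Pred X q → Pred X (suc p ⊔ q)
  int₁ S = ∁ (↓ ∁ (int S))

  IsDMSet : ∀ {q} → Pred X q → Set (suc p ⊔ q)
  IsDMSet U = IsOpen U × IsUpset U × int₁ (cl₂ U) ≐ U

{-# OPTIONS --safe #-}

-- For N = ⟨a,b⟩ and W = X ∖ ↓(𝔰 a ∖ 𝔰 b), compactness gives W = ⋃ {𝔰 n : n ∈ N}. Hence
-- 𝔰 e ⊆ cl₂ W iff e ∈ Nᵘˡ, while 𝔰 e ⊆ W iff e ∈ N.
-- Since int₁ S is the union of the 𝔰 e contained in S, W is a DM-set iff N = Nᵘˡ. A clopen U
-- is a union of such differences 𝔰 a ∖ 𝔰 b, so X ∖ ↓U is an intersection of sets W, and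
-- int₁ cl₂ is monotone; only the openness of X ∖ ↓U needs compactness once more.
--
-- Compactness is the existence of a prime filter maximal among the filters avoiding an
-- ideal. Zorn's lemma for it comes from Zermelo's tower: the closure of a base set under
-- one-step proper extension and unions is a chain, so its union has no proper extension.
module Submission where

open import Defs
open import Level using (Level; _⊔_; suc; Lift; lift; lower; 0ℓ)
open import Data.Bool.Base using (Bool; true)
open import Data.Bool.Properties using (⇔→≡; _≟_)
open import Data.Product.Base using (_×_; _,_; proj₁; proj₂; ∃; ∃₂; ∃-syntax)
open import Data.Sum.Base using (_⊎_; inj₁; inj₂; [_,_]′; map)
open import Data.Empty using (⊥-elim)
open import Function.Base using (id; _∘_)
open import Function.Bundles using (_⇔_; mk⇔)
open import Relation.Binary.PropositionalEquality as ≡ using (_≡_)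
open import Relation.Nullary using (Dec; yes; no; does; ¬_)
open import Relation.Nullary.Decidable using (dec-true; map′; decidable-stable)
open import Relation.Binary.Definitions using (_Respects_)
import Relation.Binary.Lattice.Properties.MeetSemilattice as MeetSemilatticeProperties
open import Relation.Unary using (Pred; _∈_; _∉_; _⊆_; ∁; _∖_)
open import Axiom.ExcludedMiddle using (ExcludedMiddle)
open import Axiom.Extensionality.Propositional using (Extensionality; lower-extensionality)

private
  variable
    a : Level

-- Excluded middle and Boolean-valued subsets.

lower-excludedMiddle : ∀ b → ExcludedMiddle (a ⊔ b) → ExcludedMiddle a
lower-excludedMiddle b em = map′ lower lift (em {Lift b _})

does-true⁻ : {P : Set a} (P? : Dec P) → does P? ≡ true → P
does-true⁻ (yes p) _ = p

-- Boolean-valued subsets: extensionally equal ones are propositionally equal,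
-- so a choice depending on such a subset is automatically extensional.
Subset : Set a → Set a
Subset E = E → Bool

⟦_⟧ : {E : Set a} → Subset E → Pred E 0ℓ
⟦ S ⟧ x = S x ≡ true

module Subsets {c} {E : Set c} (em : ExcludedMiddle c) where

  ⋃ : Pred (Subset E) c → Subset E
  ⋃ K x = does (em {∃[ S ] S ∈ K × x ∈ ⟦ S ⟧})

  ⋃⁺ : ∀ K {S} → S ∈ K → ⟦ S ⟧ ⊆ ⟦ ⋃ K ⟧
  ⋃⁺ K {S} S∈K x∈S = dec-true em (S , S∈K , x∈S)

  ⋃⁻ : ∀ K {x} → x ∈ ⟦ ⋃ K ⟧ → ∃[ S ] S ∈ K × x ∈ ⟦ S ⟧
  ⋃⁻ K = does-true⁻ em

-- Zorn's lemma by Zermelo's tower.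

module Zorn {c q} {E : Set c} (em : ExcludedMiddle (c ⊔ q)) (ext : Extensionality c 0ℓ)
            (P : Pred (Subset E) q) (S₀ : Subset E) (PS₀ : P S₀) where

  private
    em₀ : ExcludedMiddle c
    em₀ = lower-excludedMiddle q em

  open Subsets {E = E} em₀

  ⊆-antisym : ∀ {S S′ : Subset E} → ⟦ S ⟧ ⊆ ⟦ S′ ⟧ → ⟦ S′ ⟧ ⊆ ⟦ S ⟧ → S ≡ S′
  ⊆-antisym S⊆S′ S′⊆S = ext λ x → ⇔→≡ (mk⇔ (S⊆S′ {x}) S′⊆S)

  IsChain : Pred (Subset E) c → Set c
  IsChain K = ∀ {S S′} → S ∈ K → S′ ∈ K → ⟦ S ⟧ ⊆ ⟦ S′ ⟧ ⊎ ⟦ S′ ⟧ ⊆ ⟦ S ⟧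

  ProperExtension : Subset E → Set (c ⊔ q)
  ProperExtension S = ∃[ S′ ] P S′ × ⟦ S ⟧ ⊆ ⟦ S′ ⟧ × ¬ (⟦ S′ ⟧ ⊆ ⟦ S ⟧)

  private
    extend′ : ∀ S → Dec (ProperExtension S) → Subset E
    extend′ S (yes (S′ , _)) = S′
    extend′ S (no  _)        = S

  extend : Subset E → Subset E
  extend S = extend′ S em

  ⊆-extend : ∀ S → ⟦ S ⟧ ⊆ ⟦ extend S ⟧
  ⊆-extend S with em {ProperExtension S}
  ... | yes (_ , _ , S⊆S′ , _) = S⊆S′
  ... | no  _                  = id

  P-extend : ∀ {S} → P S → P (extend S)
  P-extend {S} PS with em {ProperExtension S}
  ... | yes (_ , PS′ , _) = PS′
  ... | no  _             = PS

  extend-⊆⇒maximal : ∀ {S} → ⟦ extend S ⟧ ⊆ ⟦ S ⟧ → ¬ ProperExtension S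
  extend-⊆⇒maximal {S} e⊆S with em {ProperExtension S}
  ... | yes (_ , _ , _ , S′⊈S) = λ _ → S′⊈S e⊆S
  ... | no  none               = none

  -- The families K are Boolean-valued to keep Tower at level c, so that Tower
  -- itself can serve as a family.
  data Tower : Subset E → Set c where
    base  : Tower S₀
    step  : ∀ {S} → Tower S → Tower (extend S)
    union : (K : Subset (Subset E)) → (∀ {S} → S ∈ ⟦ K ⟧ → Tower S) →
            ∃ ⟦ K ⟧ → Tower (⋃ λ S → Lift c (S ∈ ⟦ K ⟧))

  S₀-least : ∀ {S} → Tower S → ⟦ S₀ ⟧ ⊆ ⟦ S ⟧
  S₀-least base                        x∈S₀ = x∈S₀
  S₀-least (step {S} t)                x∈S₀ = ⊆-extend S (S₀-least t x∈S₀)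
  S₀-least (union K K⊆Tower (S , S∈K)) x∈S₀ = ⋃⁺ _ (lift S∈K) (S₀-least (K⊆Tower S∈K) x∈S₀)

  private
    -- If some member of `K` includes `Z`, so does the union; otherwise every member lies in `Y`.
    -- This settles the union case of both inductions below.
    union-dichotomy : ∀ K {Y Z} → (∀ {S} → S ∈ ⟦ K ⟧ → ⟦ S ⟧ ⊆ ⟦ Y ⟧ ⊎ ⟦ Z ⟧ ⊆ ⟦ S ⟧) →
                      let U = ⋃ λ S → Lift c (S ∈ ⟦ K ⟧) in
                      ⟦ U ⟧ ⊆ ⟦ Y ⟧ ⊎ ⟦ Z ⟧ ⊆ ⟦ U ⟧
    union-dichotomy K {Y} {Z} split with em₀ {∃[ S ] S ∈ ⟦ K ⟧ × ⟦ Z ⟧ ⊆ ⟦ S ⟧}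
    ... | yes (S , S∈K , Z⊆S) = inj₂ λ x∈Z → ⋃⁺ _ (lift S∈K) (Z⊆S x∈Z)
    ... | no none = inj₁ λ x∈U → case-⋃ (⋃⁻ _ x∈U)
      where
      case-⋃ : ∀ {x} → ∃[ S ] Lift c (S ∈ ⟦ K ⟧) × x ∈ ⟦ S ⟧ → x ∈ ⟦ Y ⟧
      case-⋃ (S , lift S∈K , x∈S) with split S∈K
      ... | inj₁ S⊆Y = S⊆Y x∈S
      ... | inj₂ Z⊆S = ⊥-elim (none (S , S∈K , Z⊆S))

  -- Induction on `S`, with an induction on `S′` nested in the successor case. Once `S ⊆ S′`, the
  -- inner induction yields `extend S ⊆ S′` or `S′ ⊆ S`, and the latter makes the two sets equal.
  tower-dichotomy : ∀ {S S′} → Tower S → Tower S′ →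
                    ⟦ S ⟧ ⊆ ⟦ S′ ⟧ ⊎ ⟦ extend S′ ⟧ ⊆ ⟦ S ⟧
  tower-dichotomy base t′ = inj₁ (S₀-least t′)
  tower-dichotomy (union K K⊆Tower _) t′ =
    union-dichotomy K λ S∈K → tower-dichotomy (K⊆Tower S∈K) t′
  tower-dichotomy {S′ = S′} (step {S} t) t′ with tower-dichotomy t t′
  ... | inj₂ e⊆S = inj₂ λ x∈e → ⊆-extend S (e⊆S x∈e)
  ... | inj₁ S⊆S′ with comparable t′
    where
    comparable : ∀ {Y} → Tower Y → ⟦ Y ⟧ ⊆ ⟦ S ⟧ ⊎ ⟦ extend S ⟧ ⊆ ⟦ Y ⟧
    comparable base = inj₁ (S₀-least t)
    comparable (union K K⊆Tower _) = union-dichotomy K λ Y∈K → comparable (K⊆Tower Y∈K)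
    comparable (step {Y} u) with comparable u
    ... | inj₂ e⊆Y = inj₂ λ x∈e → ⊆-extend Y (e⊆Y x∈e)
    ... | inj₁ Y⊆S with tower-dichotomy t u
    ...   | inj₂ e⊆S = inj₁ e⊆S
    -- Mutual inclusion gives propositional equality, so `extend S` and `extend Y` become the same
    -- set.
    ...   | inj₁ S⊆Y with ≡.refl ← ⊆-antisym {Y} {S} Y⊆S S⊆Y = inj₂ id
  ...   | inj₂ e⊆S′ = inj₁ e⊆S′
  ...   | inj₁ S′⊆S with ≡.refl ← ⊆-antisym {S′} {S} S′⊆S S⊆S′ = inj₂ id

  tower-chain : IsChain Tower
  tower-chain {S} {S′} t t′ with tower-dichotomy t t′
  ... | inj₁ S⊆S′ = inj₁ S⊆S′
  ... | inj₂ e⊆S  = inj₂ λ x∈S′ → e⊆S (⊆-extend S′ x∈S′)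

  module _ (P-⋃ : ∀ K → IsChain K → ∃ K → K ⊆ P → P (⋃ K)) where

    tower-P : ∀ {S} → Tower S → P S
    tower-P base     = PS₀
    tower-P (step t) = P-extend (tower-P t)
    tower-P (union K K⊆Tower (S , S∈K)) =
      P-⋃ _ (λ (lift S∈K) (lift S′∈K) → tower-chain (K⊆Tower S∈K) (K⊆Tower S′∈K))
            (S , lift S∈K) (λ (lift S∈K) → tower-P (K⊆Tower S∈K))

    -- The union `M` of the whole tower is again in the tower, hence so is `extend M`, which is
    -- therefore included in `M`.
    maximal : ∃[ M ] P M × ⟦ S₀ ⟧ ⊆ ⟦ M ⟧ × (∀ {S} → P S → ⟦ M ⟧ ⊆ ⟦ S ⟧ → ⟦ S ⟧ ⊆ ⟦ M ⟧)
    maximal = M , tower-P M∈Tower , S₀-least M∈Tower , λ {S} PS M⊆S {x} x∈S →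
      decidable-stable (M x ≟ true) λ x∉M → extend-⊆⇒maximal (Tower-⊆-M (step M∈Tower))
        (S , PS , M⊆S , λ S⊆M → x∉M (S⊆M x∈S))
      where
      T : Subset (Subset E)
      T S = does (em₀ {Tower S})
      M : Subset E
      M = ⋃ λ S → Lift c (S ∈ ⟦ T ⟧)
      M∈Tower : Tower M
      M∈Tower = union T (does-true⁻ em₀) (S₀ , dec-true em₀ base)
      Tower-⊆-M : ∀ {S} → Tower S → ⟦ S ⟧ ⊆ ⟦ M ⟧
      Tower-⊆-M t = ⋃⁺ _ (lift (dec-true em₀ t))

module PriestleySpace {c ℓ₁ ℓ₂} (em : ExcludedMiddle (suc (c ⊔ ℓ₁ ⊔ ℓ₂)))
                      (ext : Extensionality (suc (c ⊔ ℓ₁ ⊔ ℓ₂)) (suc (c ⊔ ℓ₁ ⊔ ℓ₂)))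
                      (A : BoundedDistributiveLattice c ℓ₁ ℓ₂) where

  private
    p = c ⊔ ℓ₁ ⊔ ℓ₂

  open BoundedDistributiveLattice A
  open ProHeyting A
  open Priestley A
  open MeetSemilatticeProperties meetSemilattice using (∧-monotonic)

  private
    em-c : ExcludedMiddle c
    em-c = lower-excludedMiddle (suc p) em

    em-p : ExcludedMiddle p
    em-p = lower-excludedMiddle (suc p) em

    by-contradiction : {P : Set (suc p)} → ¬ ¬ P → P
    by-contradiction = decidable-stable em

  -- Filters and ideals.

  record IsFilter {q} (F : Pred Carrier q) : Set (c ⊔ ℓ₂ ⊔ q) where
    field
      up-closed : F Respects _≤_
      ⊤-closed  : ⊤ ∈ F
      ∧-closed  : ∀ {x y} → x ∈ F → y ∈ F → x ∧ y ∈ F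

  record IsIdeal {q} (I : Pred Carrier q) : Set (c ⊔ ℓ₂ ⊔ q) where
    field
      down-closed : IsDownset I
      ⊥-closed    : ⊥ ∈ I
      ∨-closed    : ∀ {x y} → x ∈ I → y ∈ I → x ∨ y ∈ I

  open IsFilter
  open IsIdeal

  -- The `Lift` lets a principal filter be used at the level where the separation lemmas expect it.
  ≥-filter : ∀ q a → IsFilter (λ x → Lift q (a ≤ x))
  ≥-filter q a = record
    { up-closed = λ x≤y (lift a≤x) → lift (trans a≤x x≤y)
    ; ⊤-closed  = lift (maximum a)
    ; ∧-closed  = λ (lift a≤x) (lift a≤y) → lift (∧-greatest a≤x a≤y)
    }

  ≤-ideal : ∀ q b → IsIdeal (λ x → Lift q (x ≤ b))
  ≤-ideal q b = record
    { down-closed = λ y≤x (lift x≤b) → lift (trans y≤x x≤b)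
    ; ⊥-closed    = lift (minimum b)
    ; ∨-closed    = λ (lift x≤b) (lift y≤b) → lift (∨-least x≤b y≤b)
    }

  member-isFilter : ∀ x → IsFilter (member x)
  member-isFilter x = record
    { up-closed = up x ; ⊤-closed = ⊤-member x ; ∧-closed = ∧-member x }

  non-member-isIdeal : ∀ x → IsIdeal (∁ (member x))
  non-member-isIdeal x = record
    { down-closed = λ b≤a a∉x b∈x → a∉x (up x b≤a b∈x)
    ; ⊥-closed    = ⊥-proper x
    ; ∨-closed    = λ a∉x b∉x a∨b∈x → [ a∉x , b∉x ]′ (prime x a∨b∈x)
    }

  -- Prime filters avoiding an ideal.

  module _ {G : Pred Carrier p} {I : Pred Carrier (suc p)}
           (G-filter : IsFilter G) (I-ideal : IsIdeal I) (G∩I=∅ : G ⊆ ∁ I) where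

    private
      open Subsets {E = Carrier} em-c

      FilterAvoidingI : Pred (Subset Carrier) (suc p)
      FilterAvoidingI S = IsFilter ⟦ S ⟧ × ⟦ S ⟧ ⊆ ∁ I

      G? : Subset Carrier
      G? x = does (em-p {G x})

      G?-ok : FilterAvoidingI G?
      G?-ok = record
        { up-closed = λ x≤y x∈G → dec-true em-p (up-closed G-filter x≤y (does-true⁻ em-p x∈G))
        ; ⊤-closed  = dec-true em-p (⊤-closed G-filter)
        ; ∧-closed  = λ x∈G y∈G →
            dec-true em-p (∧-closed G-filter (does-true⁻ em-p x∈G) (does-true⁻ em-p y∈G))
        } , λ x∈G → G∩I=∅ (does-true⁻ em-p x∈G)

      open Zorn {q = suc p} em (lower-extensionality (suc p) (suc p) ext) FilterAvoidingI G? G?-ok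

      chain-⋃ : ∀ K → IsChain K → ∃ K → K ⊆ FilterAvoidingI → FilterAvoidingI (⋃ K)
      chain-⋃ K chain (S₁ , S₁∈K) K-ok = record
        { up-closed = λ x≤y x∈⋃ → let (S , S∈K , x∈S) = ⋃⁻ K x∈⋃ in
            ⋃⁺ K S∈K (up-closed (proj₁ (K-ok S∈K)) x≤y x∈S)
        ; ⊤-closed  = ⋃⁺ K S₁∈K (⊤-closed (proj₁ (K-ok S₁∈K)))
        ; ∧-closed  = λ x∈⋃ y∈⋃ → ∧-in-⋃ (⋃⁻ K x∈⋃) (⋃⁻ K y∈⋃)
        } , λ x∈⋃ → let (S , S∈K , x∈S) = ⋃⁻ K x∈⋃ in proj₂ (K-ok S∈K) x∈S
        where
        ∧-in-⋃ : ∀ {x y} → ∃[ S ] S ∈ K × x ∈ ⟦ S ⟧ → ∃[ S ] S ∈ K × y ∈ ⟦ S ⟧ →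
                 x ∧ y ∈ ⟦ ⋃ K ⟧
        ∧-in-⋃ (S , S∈K , x∈S) (S′ , S′∈K , y∈S′) with chain S∈K S′∈K
        ... | inj₁ S⊆S′ = ⋃⁺ K S′∈K (∧-closed (proj₁ (K-ok S′∈K)) (S⊆S′ x∈S) y∈S′)
        ... | inj₂ S′⊆S = ⋃⁺ K S∈K (∧-closed (proj₁ (K-ok S∈K)) x∈S (S′⊆S y∈S′))

    abstract
      -- Zorn's lemma for filters avoiding `I`. The last clause records maximality: adjoining `b` to
      -- `z` gives a filter that meets `I`. It yields primeness here and membership in a closed set
      -- in the compactness argument.
      prime-filter-avoiding :
        ∃[ z ] G ⊆ member z × member z ⊆ ∁ I ×
               (∀ {b} → b ∉ member z → ∃[ s ] s ∈ member z × s ∧ b ∈ I)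
      prime-filter-avoiding with maximal chain-⋃
      ... | M , (M-filter , M∩I=∅) , G⊆M , M-max =
        z , (λ x∈G → lift (G⊆M (dec-true em-p x∈G)))
          , (λ (lift x∈M) → M∩I=∅ x∈M)
          , λ b∉z → let (s , s∈M , s∧b∈I) = maximality (λ b∈M → b∉z (lift b∈M)) in
                    s , lift s∈M , s∧b∈I
        where
        maximality : ∀ {b} → b ∉ ⟦ M ⟧ → ∃[ s ] s ∈ ⟦ M ⟧ × s ∧ b ∈ I
        -- Otherwise the filter generated by `M` and `b` still avoids `I`, so it is included in `M`,
        -- and `b` belongs to `M`.
        maximality {b} b∉M = by-contradiction λ none → b∉M
          (M-max (M+b-filter , λ x∈M+b x∈I →
                    let (s , s∈M , s∧b≤x) = M+b⁻ x∈M+b in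
                    none (s , s∈M , down-closed I-ideal s∧b≤x x∈I))
                 (λ {x} x∈M → M+b⁺ (x , x∈M , x∧y≤x x b))
                 (M+b⁺ (⊤ , ⊤-closed M-filter , x∧y≤y ⊤ b)))
          where
          Generated : Pred Carrier (c ⊔ ℓ₂)
          Generated x = ∃[ s ] s ∈ ⟦ M ⟧ × s ∧ b ≤ x
          em-g : ExcludedMiddle (c ⊔ ℓ₂)
          em-g = lower-excludedMiddle (suc p) em
          M+b : Subset Carrier
          M+b x = does (em-g {Generated x})
          M+b⁺ : Generated ⊆ ⟦ M+b ⟧
          M+b⁺ = dec-true em-g
          M+b⁻ : ⟦ M+b ⟧ ⊆ Generated
          M+b⁻ = does-true⁻ em-g
          M+b-filter : IsFilter ⟦ M+b ⟧
          M+b-filter = record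
            { up-closed = λ x≤y x∈ → let (s , s∈M , s∧b≤x) = M+b⁻ x∈ in
                M+b⁺ (s , s∈M , trans s∧b≤x x≤y)
            ; ⊤-closed  = M+b⁺ (⊤ , ⊤-closed M-filter , maximum _)
            ; ∧-closed  = λ x∈ y∈ →
                let (s , s∈M , s∧b≤x) = M+b⁻ x∈
                    (t , t∈M , t∧b≤y) = M+b⁻ y∈
                in M+b⁺ (s ∧ t , ∧-closed M-filter s∈M t∈M ,
                     ∧-greatest (trans (∧-monotonic (x∧y≤x s t) refl) s∧b≤x)
                                (trans (∧-monotonic (x∧y≤y s t) refl) t∧b≤y))
            }

        M-prime : ∀ {a b} → a ∨ b ∈ ⟦ M ⟧ → a ∈ ⟦ M ⟧ ⊎ b ∈ ⟦ M ⟧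
        M-prime {a} {b} a∨b∈M with M a ≟ true | M b ≟ true
        ... | yes a∈M | _       = inj₁ a∈M
        ... | no  _   | yes b∈M = inj₂ b∈M
        ... | no a∉M  | no b∉M  =
          -- By distributivity, `(s ∧ t) ∧ (a ∨ b)` lies below `(s ∧ a) ∨ (t ∧ b)`, so it would be
          -- in both `M` and `I`.
          let (s , s∈M , s∧a∈I) = maximality a∉M
              (t , t∈M , t∧b∈I) = maximality b∉M
          in ⊥-elim (M∩I=∅
               (∧-closed M-filter (∧-closed M-filter s∈M t∈M) a∨b∈M)
               (down-closed I-ideal
                 (trans (reflexive (∧-distribˡ-∨ (s ∧ t) a b))
                   (∨-least (trans (∧-monotonic (x∧y≤x s t) refl) (x≤x∨y _ _))
                            (trans (∧-monotonic (x∧y≤y s t) refl) (y≤x∨y _ _))))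
                 (∨-closed I-ideal s∧a∈I t∧b∈I)))

        z : X
        z = record
          { member   = λ x → Lift p (x ∈ ⟦ M ⟧)
          ; up       = λ x≤y (lift x∈M) → lift (up-closed M-filter x≤y x∈M)
          ; ⊤-member = lift (⊤-closed M-filter)
          ; ∧-member = λ (lift x∈M) (lift y∈M) → lift (∧-closed M-filter x∈M y∈M)
          ; ⊥-proper = λ (lift ⊥∈M) → M∩I=∅ ⊥∈M (⊥-closed I-ideal)
          ; prime    = λ (lift a∨b∈M) → map lift lift (M-prime a∨b∈M)
          }

  -- If `a ≤ b` fails, the filter above `a` avoids the ideal below `b`, and a prime filter separates
  -- them.
  𝔰-reflects-≤ : ∀ {a b} → 𝔰 a ⊆ 𝔰 b → a ≤ b
  𝔰-reflects-≤ {a} {b} 𝔰a⊆𝔰b = decidable-stable (lower-excludedMiddle (suc p) em) λ a≰b →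
    let (z , a∈z , b∉z , _) = prime-filter-avoiding (≥-filter p a) (≤-ideal (suc p) b)
                                (λ (lift a≤x) (lift x≤b) → a≰b (trans a≤x x≤b))
    in b∉z (𝔰a⊆𝔰b {z} (a∈z (lift refl))) (lift refl)

  -- Compactness and separation from closed sets.

  abstract
    -- Compactness: for a closed set F, the ideal {c : F ∩ 𝔰 c ⊆ 𝔰 d for some d ∈ J}
    -- either meets G or is avoided by a maximal filter, which then lies in F.
    closed-separation : ∀ {F : Pred X (suc p)} {G J : Pred Carrier p} →
      IsClosed F → IsFilter G → IsIdeal J →
      (∀ z → z ∈ F → G ⊆ member z → ¬ (J ⊆ ∁ (member z))) →
      ∃₂ λ c d → c ∈ G × d ∈ J × (∀ z → z ∈ F → z ∈ 𝔰 c → z ∈ 𝔰 d)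
    closed-separation {F} {G} {J} F-closed G-filter J-ideal no-point =
      by-contradiction λ none →
        let (z , G⊆z , z∩I=∅ , z-max) = prime-filter-avoiding G-filter I-ideal
              (λ {c} c∈G (d , d∈J , F∩c⊆d) → none (c , d , c∈G , d∈J , F∩c⊆d))
        in no-point z (z∈F z z∩I=∅ z-max) G⊆z
             (λ {d} d∈J d∈z → z∩I=∅ d∈z (d , d∈J , λ _ _ d∈w → d∈w))
      where
      I : Pred Carrier (suc p)
      I c = ∃[ d ] d ∈ J × (∀ w → w ∈ F → w ∈ 𝔰 c → w ∈ 𝔰 d)

      I-ideal : IsIdeal I
      I-ideal = record
        { down-closed = λ y≤x (d , d∈J , F∩x⊆d) →
            d , d∈J , λ w w∈F y∈w → F∩x⊆d w w∈F (up w y≤x y∈w)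
        ; ⊥-closed    = ⊥ , ⊥-closed J-ideal , λ _ _ ⊥∈w → ⊥∈w
        ; ∨-closed    = λ (d , d∈J , F∩x⊆d) (e , e∈J , F∩y⊆e) →
            d ∨ e , ∨-closed J-ideal d∈J e∈J , λ w w∈F x∨y∈w →
              [ (λ x∈w → up w (x≤x∨y d e) (F∩x⊆d w w∈F x∈w))
              , (λ y∈w → up w (y≤x∨y d e) (F∩y⊆e w w∈F y∈w)) ]′ (prime w x∨y∈w)
        }

      z∈F : ∀ z → member z ⊆ ∁ I →
            (∀ {b} → b ∉ member z → ∃[ s ] s ∈ member z × s ∧ b ∈ I) → z ∈ F
      -- Suppose a basic set `𝔰 a ∖ 𝔰 b` around `z` misses `F`, and `s ∧ b` is in `I`. On `F`,
      -- `𝔰 (s ∧ a)` is then included in `𝔰 (s ∧ b)`, so `s ∧ a` is in `I` as well as in `z`.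
      z∈F z z∩I=∅ z-max = by-contradiction λ z∉F →
        let (a , b , (a∈z , b∉z) , a∖b⊆∁F) = F-closed z∉F
            (s , s∈z , d , d∈J , F∩s∧b⊆d) = z-max b∉z
        in z∩I=∅ (∧-member z s∈z a∈z) (d , d∈J , λ w w∈F s∧a∈w →
             decidable-stable em-p λ d∉w →
               a∖b⊆∁F {w} (up w (x∧y≤y s a) s∧a∈w , λ b∈w →
                 d∉w (F∩s∧b⊆d w w∈F (∧-member w (up w (x∧y≤x s a) s∧a∈w) b∈w))) w∈F)

    -- Compactness with `x` as the filter and the ideal below `⊥`: a common point would be a point
    -- of `F` above `x`.
    ↓-closed-separation : ∀ (F : Pred X (suc p)) → IsClosed F → ∀ x → x ∉ ↓ F →
                          ∃[ c ] x ∈ 𝔰 c × F ⊆ ∁ (𝔰 c)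
    ↓-closed-separation F F-closed x x∉↓F =
      let (c , d , c∈x , lift d≤⊥ , F∩c⊆d) =
            closed-separation F-closed (member-isFilter x) (≤-ideal p ⊥)
              (λ z z∈F x⊑z _ → x∉↓F (z , z∈F , x⊑z))
      in c , c∈x , λ {z} z∈F c∈z → ⊥-proper z (up z d≤⊥ (F∩c⊆d z z∈F c∈z))

    -- The dual choice: the filter above `⊤` and the complement of `x` as the ideal.
    ↑-closed-separation : ∀ (F : Pred X (suc p)) → IsClosed F → ∀ x → x ∉ ↑ F →
                          ∃[ d ] x ∉ 𝔰 d × F ⊆ 𝔰 d
    ↑-closed-separation F F-closed x x∉↑F =
      let (c , d , lift ⊤≤c , d∉x , F∩c⊆d) =
            closed-separation F-closed (≥-filter p ⊤) (non-member-isIdeal x)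
              (λ z z∈F _ x∩z=∅ → x∉↑F (z , z∈F , λ a∈z →
                decidable-stable em-p λ a∉x → x∩z=∅ a∉x a∈z))
      in d , d∉x , λ {z} z∈F → F∩c⊆d z z∈F (up z ⊤≤c (⊤-member z))

  -- Clopen sets.

  -- A copy of `𝔰` at the level over which the clopen sets of the theorem range.
  𝔰↑ : Carrier → Pred X (suc p)
  𝔰↑ a x = Lift (suc p) (x ∈ 𝔰 a)

  𝔰↑-clopen : ∀ a → IsClopen (𝔰↑ a)
  𝔰↑-clopen a =
    (λ {x} (lift a∈x) → a , ⊥ , (a∈x , ⊥-proper x) , λ (a∈y , _) → lift a∈y) ,
    (λ {x} a∉x → ⊤ , a , (⊤-member x , a∉x ∘ lift) , λ (_ , a∉y) (lift a∈y) → a∉y a∈y)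

  𝔰↑-upset : ∀ a → IsUpset (𝔰↑ a)
  𝔰↑-upset a x⊑y (lift a∈x) = lift (x⊑y a∈x)

  ∖-clopen : ∀ {U V : Pred X (suc p)} → IsClopen U → IsClopen V → IsClopen (U ∖ V)
  ∖-clopen {U} {V} (U-open , U-closed) (V-open , V-closed) = ∖-open , ∖-closed
    where
    ∖-open : IsOpen (U ∖ V)
    ∖-open {x} (x∈U , x∉V) =
      let (a , b , (a∈x , b∉x) , a∖b⊆U)  = U-open x∈U
          (c , d , (c∈x , d∉x) , c∖d⊆∁V) = V-closed x∉V
      in a ∧ c , b ∨ d
       , (∧-member x a∈x c∈x , λ b∨d∈x → [ b∉x , d∉x ]′ (prime x b∨d∈x))
       , λ {y} (a∧c∈y , b∨d∉y) →
           a∖b⊆U  {y} (up y (x∧y≤x a c) a∧c∈y , b∨d∉y ∘ up y (x≤x∨y b d)) ,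
           c∖d⊆∁V {y} (up y (x∧y≤y a c) a∧c∈y , b∨d∉y ∘ up y (y≤x∨y b d))
    ∖-closed : IsClosed (U ∖ V)
    ∖-closed {x} x∉U∖V with em {x ∈ V}
    ... | yes x∈V = let (a , b , x∈a∖b , a∖b⊆V) = V-open x∈V in
      a , b , x∈a∖b , λ {y} y∈a∖b (_ , y∉V) → y∉V (a∖b⊆V {y} y∈a∖b)
    ... | no  x∉V = let (a , b , x∈a∖b , a∖b⊆∁U) = U-closed (λ x∈U → x∉U∖V (x∈U , x∉V)) in
      a , b , x∈a∖b , λ {y} y∈a∖b (y∈U , _) → a∖b⊆∁U {y} y∈a∖b y∈U

  -- Closure, interior and complements of downsets.

  cl-closed : ∀ (S : Pred X (suc p)) → IsClosed (cl S)
  cl-closed S {x} x∉cl = by-contradiction λ none → x∉cl λ a b x∈a∖b →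
    by-contradiction λ disjoint →
      none (a , b , x∈a∖b , λ {y} y∈a∖b y∈cl → disjoint (y∈cl a b y∈a∖b))

  ∁-int-closed : ∀ (S : Pred X (suc p)) → IsClosed (∁ (int S))
  ∁-int-closed S x∈∁∁int with by-contradiction x∈∁∁int
  ... | a , b , x∈a∖b , a∖b⊆S = a , b , x∈a∖b , λ y∈a∖b y∉int → y∉int (a , b , y∈a∖b , a∖b⊆S)

  int-⊆ : ∀ (S : Pred X (suc p)) → int S ⊆ S
  int-⊆ S {x} (_ , _ , x∈a∖b , a∖b⊆S) = a∖b⊆S {x} x∈a∖b

  ⊆-cl₂ : ∀ (S : Pred X (suc p)) → S ⊆ cl₂ S
  ⊆-cl₂ S {x} x∈S = x , (λ a b x∈a∖b → x , x∈a∖b , x∈S) , id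

  open-upset⊆int₁ : ∀ (U S : Pred X (suc p)) → IsOpen U → IsUpset U → U ⊆ S → U ⊆ int₁ S
  open-upset⊆int₁ U S U-open U-up U⊆S {x} x∈U (y , y∉int , x⊑y) =
    let (a , b , y∈a∖b , a∖b⊆U) = U-open {y} (U-up {x} {y} x⊑y x∈U)
    in y∉int (a , b , y∈a∖b , λ {w} w∈a∖b → U⊆S {w} (a∖b⊆U {w} w∈a∖b))

  -- The complement of `int S` is closed and `x` is outside its downset, so some `𝔰 e` containing
  -- `x` misses it.
  int₁⇒𝔰⊆ : ∀ (S : Pred X (suc p)) x → x ∈ int₁ S → ∃[ e ] x ∈ 𝔰 e × 𝔰 e ⊆ S
  int₁⇒𝔰⊆ S x x∈int₁ =
    let (e , e∈x , ∁int⊆∁𝔰e) = ↓-closed-separation (∁ (int S)) (λ {x} → ∁-int-closed S {x}) x x∈int₁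
    in e , e∈x , λ {y} e∈y → int-⊆ S (by-contradiction λ y∉int → ∁int⊆∁𝔰e {y} y∉int e∈y)

  int₁-cl₂-mono : ∀ (S T : Pred X (suc p)) → S ⊆ T → int₁ (cl₂ S) ⊆ int₁ (cl₂ T)
  int₁-cl₂-mono S T S⊆T x∈int₁ (y , y∉int , x⊑y) =
    x∈int₁ (y , (λ (a , b , y∈a∖b , a∖b⊆cl₂S) → y∉int (a , b , y∈a∖b , λ {w} w∈a∖b →
      let (v , v∈cl , v⊑w) = a∖b⊆cl₂S {w} w∈a∖b
      in v , (λ c d v∈c∖d → let (u , u∈c∖d , u∈S) = v∈cl c d v∈c∖d in u , u∈c∖d , S⊆T {u} u∈S)
           , v⊑w)) , x⊑y)

  ∁↓-upset : ∀ (U : Pred X (suc p)) → IsUpset (∁ (↓ U))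
  ∁↓-upset U x⊑y x∉↓U (z , z∈U , y⊑z) = x∉↓U (z , z∈U , λ a∈x → y⊑z (x⊑y a∈x))

  ∁↓-open : ∀ (U : Pred X (suc p)) → IsClosed U → IsOpen (∁ (↓ U))
  ∁↓-open U U-closed {x} x∉↓U =
    let (c , c∈x , U⊆∁𝔰c) = ↓-closed-separation U U-closed x x∉↓U
    in c , ⊥ , (c∈x , ⊥-proper x) , λ (c∈y , _) (z , z∈U , y⊑z) → U⊆∁𝔰c {z} z∈U (y⊑z c∈y)

  -- Relative annihilators as open upsets.

  -- W a b is the union of the sets 𝔰 n with n ∈ ⟨ a , b ⟩, as W⁺ and W⁻ show.
  W : Carrier → Carrier → Pred X (suc p)
  W a b = ∁ (↓ (𝔰↑ a ∖ 𝔰↑ b))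

  W⁺ : ∀ {a b n} x → n ∈ ⟨ a , b ⟩ → x ∈ 𝔰 n → x ∈ W a b
  W⁺ x a∧n≤b n∈x (z , (lift a∈z , b∉z) , x⊑z) =
    b∉z (lift (up z a∧n≤b (∧-member z a∈z (x⊑z n∈x))))

  W⁻ : ∀ {a b} x → x ∈ W a b → ∃[ n ] n ∈ ⟨ a , b ⟩ × x ∈ 𝔰 n
  W⁻ {a} {b} x x∈W =
    let (n , n∈x , a∖b⊆∁𝔰n) =
          ↓-closed-separation (𝔰↑ a ∖ 𝔰↑ b)
            (λ {y} → proj₂ (∖-clopen {𝔰↑ a} {𝔰↑ b} (𝔰↑-clopen a) (𝔰↑-clopen b)) {y}) x x∈W
    -- As `𝔰 n` misses `𝔰 a ∖ 𝔰 b`, every point of `𝔰 (a ∧ n)` is in `𝔰 b`.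
    in n , 𝔰-reflects-≤ (λ {y} a∧n∈y → decidable-stable em-p λ b∉y →
             a∖b⊆∁𝔰n {y} (lift (up y (x∧y≤x a n) a∧n∈y) , b∉y ∘ lower) (up y (x∧y≤y a n) a∧n∈y))
         , n∈x

  -- `𝔰 u` is a closed upset: a point `y` outside it has the neighbourhood `𝔰 ⊤ ∖ 𝔰 u`, which misses
  -- `S`.
  cl₂-⊆-𝔰 : ∀ (S : Pred X (suc p)) {u} → S ⊆ 𝔰 u → cl₂ S ⊆ 𝔰 u
  cl₂-⊆-𝔰 S {u} S⊆𝔰u (y , y∈cl , y⊑x) = y⊑x (decidable-stable em-p λ u∉y →
    let (w , (_ , u∉w) , w∈S) = y∈cl ⊤ u (⊤-member y , u∉y) in u∉w (S⊆𝔰u {w} w∈S))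

  -- The implications between the three conditions.

  proHeyting⇒W-DM : IsProHeyting → ∀ a b → int₁ (cl₂ (W a b)) ⊆ W a b
  proHeyting⇒W-DM pH a b {x} x∈int₁ =
    let (e , e∈x , 𝔰e⊆cl₂W) = int₁⇒𝔰⊆ (cl₂ (W a b)) x x∈int₁
        -- An upper bound `u` of the annihilator gives `W a b ⊆ 𝔰 u`, hence
        -- `𝔰 e ⊆ cl₂ (W a b) ⊆ 𝔰 u`.
        e∈Nᵘˡ = λ u u∈Nᵘ → 𝔰-reflects-≤ λ {y} e∈y →
          cl₂-⊆-𝔰 (W a b) (λ {w} → W⊆𝔰 u∈Nᵘ w) {y} (𝔰e⊆cl₂W {y} e∈y)
    in W⁺ x (proj₂ (proj₂ (pH a b)) e∈Nᵘˡ) e∈x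
    where
    W⊆𝔰 : ∀ {u} → u ∈ ⟨ a , b ⟩ ᵘ → ∀ w → w ∈ W a b → w ∈ 𝔰 u
    W⊆𝔰 u∈Nᵘ w w∈W = let (n , n∈N , n∈w) = W⁻ w w∈W in up w (u∈Nᵘ n n∈N) n∈w

  ClopenUpsetsDM : Set (suc (suc p))
  ClopenUpsetsDM = ∀ (U V : Pred X (suc p)) → IsClopen U → IsUpset U → IsClopen V → IsUpset V →
                   IsDMSet (∁ (↓ (U ∖ V)))

  ClopensDM : Set (suc (suc p))
  ClopensDM = ∀ (U : Pred X (suc p)) → IsClopen U → IsDMSet (∁ (↓ U))

  proHeyting⇒clopensDM : IsProHeyting → ClopensDM
  proHeyting⇒clopensDM pH U (U-open , U-closed) =
    (λ {x} → D-open {x}) , (λ {x y} → D-upset {x} {y}) , (λ {x} → int₁-cl₂-⊆ x) ,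
    λ {x} → open-upset⊆int₁ D (cl₂ D) (λ {x} → D-open {x}) (λ {x y} → D-upset {x} {y})
              (λ {x} → ⊆-cl₂ D {x}) {x}
    where
    D : Pred X (suc p)
    D = ∁ (↓ U)
    D-open : IsOpen D
    D-open {x} = ∁↓-open U U-closed {x}
    D-upset : IsUpset D
    D-upset {x} {y} = ∁↓-upset U {x} {y}
    int₁-cl₂-⊆ : ∀ x → x ∈ int₁ (cl₂ D) → x ∈ D
    int₁-cl₂-⊆ x x∈int₁ (y , y∈U , x⊑y) =
      -- A basic set around `y` inside `U` gives some `W a b` that includes `D` but, since `x ⊑ y`,
      -- cannot contain `x`.
      let (a , b , (a∈y , b∉y) , a∖b⊆U) = U-open y∈U
          D⊆W : D ⊆ W a b
          D⊆W = λ w∉↓U (z , (lift a∈z , b∉z) , w⊑z) →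
            w∉↓U (z , a∖b⊆U {z} (a∈z , b∉z ∘ lift) , w⊑z)
      in proHeyting⇒W-DM pH a b {x}
           (int₁-cl₂-mono D (W a b) (λ {w} → D⊆W {w}) {x} x∈int₁)
           (y , (lift a∈y , b∉y ∘ lower) , x⊑y)

  clopensDM⇒clopenUpsetsDM : ClopensDM → ClopenUpsetsDM
  clopensDM⇒clopenUpsetsDM dm U V U-clopen _ V-clopen _ = dm (U ∖ V) (∖-clopen U-clopen V-clopen)

  clopenUpsetsDM⇒proHeyting : ClopenUpsetsDM → IsProHeyting
  clopenUpsetsDM⇒proHeyting dm a b =
    (λ y≤x a∧x≤b → trans (∧-monotonic refl y≤x) a∧x≤b) ,
    (λ {n} n∈N u u∈Nᵘ → u∈Nᵘ n n∈N) ,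
    -- A point of `𝔰 (a ∧ e)` outside `𝔰 b` would be in `W a b` through `𝔰 e`, yet it is itself in
    -- `𝔰 a ∖ 𝔰 b`.
    λ {e} e∈Nᵘˡ → 𝔰-reflects-≤ λ {x} a∧e∈x → decidable-stable em-p λ b∉x →
      int₁-cl₂-W⊆W {x} (𝔰e⊆int₁-cl₂-W e∈Nᵘˡ x (lift (up x (x∧y≤y a e) a∧e∈x)))
        (x , (lift (up x (x∧y≤x a e) a∧e∈x) , b∉x ∘ lower) , id)
    where
    int₁-cl₂-W⊆W : int₁ (cl₂ (W a b)) ⊆ W a b
    int₁-cl₂-W⊆W {x} = proj₁ (proj₂ (proj₂
      (dm (𝔰↑ a) (𝔰↑ b) (𝔰↑-clopen a) (λ {x y} → 𝔰↑-upset a {x} {y})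
                        (𝔰↑-clopen b) (λ {x y} → 𝔰↑-upset b {x} {y})))) {x}

    -- A point `x` outside `cl₂ (W a b)` omits some `d` with `cl (W a b) ⊆ 𝔰 d`. Such a `d` bounds
    -- the annihilator from above, so `e ≤ d`, and `e` cannot be in `x`.
    𝔰e⊆cl₂-W : ∀ {e} → e ∈ (⟨ a , b ⟩ ᵘ) ˡ → 𝔰↑ e ⊆ cl₂ (W a b)
    𝔰e⊆cl₂-W e∈Nᵘˡ {x} (lift e∈x) = by-contradiction λ x∉cl₂W →
      let (d , d∉x , clW⊆𝔰d) = ↑-closed-separation (cl (W a b)) (λ {x} → cl-closed (W a b) {x}) x x∉cl₂W
          d∈Nᵘ = λ n n∈N → 𝔰-reflects-≤ λ {y} n∈y →
            clW⊆𝔰d {y} (λ _ _ y∈c∖d → y , y∈c∖d , W⁺ y n∈N n∈y)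
      in d∉x (up x (e∈Nᵘˡ d d∈Nᵘ) e∈x)

    𝔰e⊆int₁-cl₂-W : ∀ {e} → e ∈ (⟨ a , b ⟩ ᵘ) ˡ → ∀ x → x ∈ 𝔰↑ e → x ∈ int₁ (cl₂ (W a b))
    𝔰e⊆int₁-cl₂-W {e} e∈Nᵘˡ x =
      open-upset⊆int₁ (𝔰↑ e) (cl₂ (W a b)) (λ {x} → proj₁ (𝔰↑-clopen e) {x})
        (λ {x y} → 𝔰↑-upset e {x} {y}) (λ {x} → 𝔰e⊆cl₂-W e∈Nᵘˡ {x}) {x}

theorem5p11 :
    ∀ {c ℓ₁ ℓ₂} →
    ExcludedMiddle (suc (c ⊔ ℓ₁ ⊔ ℓ₂)) →
    Extensionality (suc (c ⊔ ℓ₁ ⊔ ℓ₂)) (suc (c ⊔ ℓ₁ ⊔ ℓ₂)) →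
    (A : BoundedDistributiveLattice c ℓ₁ ℓ₂) →
    let open ProHeyting A
        open Priestley A
        proHeyting = IsProHeyting
        clopenUpsets = ∀ (U V : Pred X (suc (c ⊔ ℓ₁ ⊔ ℓ₂))) →
                       IsClopen U → IsUpset U → IsClopen V → IsUpset V →
                       IsDMSet (∁ (↓ (U ∖ V)))
        clopens = ∀ (U : Pred X (suc (c ⊔ ℓ₁ ⊔ ℓ₂))) →
                  IsClopen U → IsDMSet (∁ (↓ U))
    in (proHeyting ⇔ clopenUpsets) × (clopenUpsets ⇔ clopens)
theorem5p11 em ext A =
  mk⇔ (clopensDM⇒clopenUpsetsDM ∘ proHeyting⇒clopensDM) clopenUpsetsDM⇒proHeyting ,
  mk⇔ (proHeyting⇒clopensDM ∘ clopenUpsetsDM⇒proHeyting) clopensDM⇒clopenUpsetsDM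
  where open PriestleySpace em ext A
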